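{- The subspace of strongly maximal elements of a continuous dcpo $D$ with the relative Scott topology is Hausdorff in the following sense: if $x,y\in D$ are strongly maximal, then $x\mathrel{\#}y$ (intrinsic apartness in $D$) if and only if there are disjoint Scott opens $U$ and $V$ such that $x\in U$ and $y\in V$.
   Context: Everything is constructive: neither excluded middle nor choice is assumed. A subset $S$ of a poset is directed if it is inhabited and any two elements of $S$ have an upper bound in $S$. A dcpo is a poset $(D,\sqsubseteq)$ in which every directed subset $S$ has a supremum $\bigsqcup S$. Write $x\ll y$ ($x$ is way below $y$) if for every directed $S$ with $y\sqsubseteq\bigsqcup S$ there is $s\in S$ with $x\sqsubseteq s$. $D$ is continuous if for every $x$ the set $\{y\in D\mid y\ll x\}$ is directed with supremum $x$. A subset $U\subseteq D$ is Scott open if it is an upper set and whenever $\bigsqcup S\in U$ with $S$ directed, some $s\in S$ is in $U$. Two points of $D$ are Hausdorff separated if they have disjoint Scott open neighbourhoods. An element $x$ of a continuous dcpo $D$ is strongly maximal if for every $u,v\in D$ with $u\ll v$, we have $u\ll x$, or $v$ and $x$ are Hausdorff separated. The intrinsic apartness on $D$: $x\mathrel{\#}y$ if there is a Scott open set containing $x$ but not $y$, or a Scott open set containing $y$ but not $x$. -}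

module Defs where

open import Level using (Level; _⊔_; suc)
open import Data.Product using (Σ-syntax; ∃-syntax; _×_; proj₁; proj₂)
open import Data.Sum using (_⊎_)
open import Function.Bundles using (_⇔_)
open import Relation.Binary.Bundles using (Poset)
open import Relation.Unary using (Pred; _∈_; _∉_; _≬_; _⊥_; Satisfiable)

private
  variable
    c ℓ₁ ℓ₂ ℓ : Level

-- A subset is a predicate on the carrier.  It is not required to respect _≈_;
-- a predicate and its closure under _≈_ have the same upper bounds.

module _ (P : Poset c ℓ₁ ℓ₂) where
  open Poset P using (Carrier) renaming (_≤_ to _⊑_)

  IsDirected : Pred Carrier ℓ → Set (c ⊔ ℓ₂ ⊔ ℓ)
  IsDirected S =
    Satisfiable S ×
    (∀ {x y} → x ∈ S → y ∈ S → ∃[ z ] z ∈ S × x ⊑ z × y ⊑ z)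

  IsUpperBound : Pred Carrier ℓ → Carrier → Set (c ⊔ ℓ₂ ⊔ ℓ)
  IsUpperBound S x = ∀ {s} → s ∈ S → s ⊑ x

  IsSupremum : Pred Carrier ℓ → Carrier → Set (c ⊔ ℓ₂ ⊔ ℓ)
  IsSupremum S x = IsUpperBound S x × (∀ {y} → IsUpperBound S y → x ⊑ y)

  IsUpperSet : Pred Carrier ℓ → Set (c ⊔ ℓ₂ ⊔ ℓ)
  IsUpperSet U = ∀ {x y} → x ⊑ y → x ∈ U → y ∈ U

-- The level ℓ fixes, once and for all, what counts as a subset of the dcpo:
-- directed sets and Scott open sets are both predicates of level ℓ.

record DCPO (c ℓ₁ ℓ₂ ℓ : Level) : Set (suc (c ⊔ ℓ₁ ⊔ ℓ₂ ⊔ ℓ)) where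
  field
    poset : Poset c ℓ₁ ℓ₂

  open Poset poset public using (Carrier; _≈_) renaming (_≤_ to _⊑_)

  Subset : Set (c ⊔ suc ℓ)
  Subset = Pred Carrier ℓ

  field
    complete : (S : Subset) → IsDirected poset S → ∃[ x ] IsSupremum poset S x

  ⨆ : (S : Subset) → IsDirected poset S → Carrier
  ⨆ S S-directed = proj₁ (complete S S-directed)

module _ (D : DCPO c ℓ₁ ℓ₂ ℓ) where
  open DCPO D

  infix 4 _≪_ _#_

  _≪_ : Carrier → Carrier → Set (c ⊔ ℓ₂ ⊔ suc ℓ)
  x ≪ y = (S : Subset) (S-directed : IsDirected poset S) →
          y ⊑ ⨆ S S-directed → ∃[ s ] s ∈ S × x ⊑ s

  -- { y ∣ y ≪ x } is directed with supremum x.  As _≪_ quantifies over all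
  -- subsets, y ≪ x is a type of level above ℓ; that { y ∣ y ≪ x } is a subset
  -- (automatic when subsets are closed under impredicative comprehension) is
  -- expressed by a predicate ↡x of level ℓ with exactly these members.
  IsContinuous : Set (c ⊔ ℓ₂ ⊔ suc ℓ)
  IsContinuous = ∀ x → Σ[ ↡x ∈ Subset ]
    (∀ y → y ∈ ↡x ⇔ y ≪ x) × IsDirected poset ↡x × IsSupremum poset ↡x x

  IsScottOpen : Subset → Set (c ⊔ ℓ₂ ⊔ suc ℓ)
  IsScottOpen U =
    IsUpperSet poset U ×
    ((S : Subset) (S-directed : IsDirected poset S) → ⨆ S S-directed ∈ U → S ≬ U)

  HausdorffSeparated : Carrier → Carrier → Set (c ⊔ ℓ₂ ⊔ suc ℓ)
  HausdorffSeparated x y =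
    ∃[ U ] ∃[ V ] IsScottOpen U × IsScottOpen V × x ∈ U × y ∈ V × U ⊥ V

  IsStronglyMaximal : Carrier → Set (c ⊔ ℓ₂ ⊔ suc ℓ)
  IsStronglyMaximal x = ∀ u v → u ≪ v → u ≪ x ⊎ HausdorffSeparated v x

  _#_ : Carrier → Carrier → Set (c ⊔ ℓ₂ ⊔ suc ℓ)
  x # y = (∃[ U ] IsScottOpen U × x ∈ U × y ∉ U) ⊎
          (∃[ U ] IsScottOpen U × y ∈ U × x ∉ U)

{-# OPTIONS --safe #-}
-- If a Scott open U contains x but not y, then by continuity some u ≪ x lies in
-- U.  Strong maximality of y, applied to u ≪ x, gives either u ≪ y, which would
-- put y in U, or a Hausdorff separation of x and y.
module Submission where

open import Defs
open import Data.Empty using (⊥-elim)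
open import Data.Product using (∃-syntax; _×_; _,_; proj₁)
open import Data.Sum using (inj₁; inj₂)
open import Function.Bundles using (_⇔_; mk⇔; module Equivalence)
open import Level using (Level)
open import Relation.Unary using (_∈_; _∉_; _⊥_)

private
  variable
    c ℓ₁ ℓ₂ ℓ : Level

module _ (D : DCPO c ℓ₁ ℓ₂ ℓ) where
  open DCPO D

  HausdorffSeparated-sym : ∀ {x y} → HausdorffSeparated D x y → HausdorffSeparated D y x
  HausdorffSeparated-sym (U , V , U-open , V-open , x∈U , y∈V , U⊥V) =
    V , U , V-open , U-open , y∈V , x∈U , λ (z∈V , z∈U) → U⊥V (z∈U , z∈V)

  HausdorffSeparated⇒# : ∀ {x y} → HausdorffSeparated D x y → _#_ D x y
  HausdorffSeparated⇒# (U , V , U-open , _ , x∈U , y∈V , U⊥V) =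
    inj₁ (U , U-open , x∈U , λ y∈U → U⊥V (y∈U , y∈V))

  module _ (continuous : IsContinuous D) where

    -- By continuity `x` is a member of a subset with supremum `y`. The textbook argument tests
    -- `x ≪ y` on the singleton of `y`, but equality with `y` lives at level `ℓ₁` or `c`, so that
    -- singleton need not be a `Subset`, which has level `ℓ`.
    ≪⇒⊑ : ∀ {x y} → _≪_ D x y → x ⊑ y
    ≪⇒⊑ {x} {y} x≪y with continuous y
    ... | _ , ∈↡⇔≪ , _ , (upper , _) = upper (Equivalence.from (∈↡⇔≪ x) x≪y)

    ScottOpen-≪-witness : ∀ {U x} → IsScottOpen D U → x ∈ U → ∃[ u ] _≪_ D u x × u ∈ U
    ScottOpen-≪-witness {U} {x} (U-upper , U-inaccessible) x∈U with continuous x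
    ... | ↡x , ∈↡⇔≪ , ↡x-directed , (_ , least)
      with complete ↡x ↡x-directed | U-inaccessible ↡x ↡x-directed
    ... | _ , (⨆-upper , _) | inaccessible
      -- The supremum chosen by `complete` need not be `x` itself. It is an upper bound of `↡x`,
      -- hence above `x` by `least`, and so in `U`; inaccessibility then finds a member of `↡x` in
      -- `U`.
      with inaccessible (U-upper (least ⨆-upper) x∈U)
    ... | u , u∈↡x , u∈U = u , Equivalence.to (∈↡⇔≪ u) u∈↡x , u∈U

    ScottOpen-separates⇒HausdorffSeparated : ∀ {U x y} → IsStronglyMaximal D y →
      IsScottOpen D U → x ∈ U → y ∉ U → HausdorffSeparated D x y
    ScottOpen-separates⇒HausdorffSeparated {x = x} y-max U-open x∈U y∉U
      with ScottOpen-≪-witness U-open x∈U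
    ... | u , u≪x , u∈U with y-max u x u≪x
    ...   | inj₁ u≪y = ⊥-elim (y∉U (proj₁ U-open (≪⇒⊑ u≪y) u∈U))
    ...   | inj₂ separated = separated

    -- In each case the strong maximality used is that of the point outside `U`; in the second case
    -- the separation comes out in reversed order.
    #⇒HausdorffSeparated : ∀ {x y} → IsStronglyMaximal D x → IsStronglyMaximal D y →
      _#_ D x y → HausdorffSeparated D x y
    #⇒HausdorffSeparated _ y-max (inj₁ (U , U-open , x∈U , y∉U)) =
      ScottOpen-separates⇒HausdorffSeparated y-max U-open x∈U y∉U
    #⇒HausdorffSeparated x-max _ (inj₂ (U , U-open , y∈U , x∉U)) =
      HausdorffSeparated-sym (ScottOpen-separates⇒HausdorffSeparated x-max U-open y∈U x∉U)

proposition6p16 : ∀ {c ℓ₁ ℓ₂ ℓ : Level} (D : DCPO c ℓ₁ ℓ₂ ℓ) → IsContinuous D →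
    (x y : DCPO.Carrier D) → IsStronglyMaximal D x → IsStronglyMaximal D y →
    _#_ D x y ⇔ (∃[ U ] ∃[ V ] IsScottOpen D U × IsScottOpen D V × x ∈ U × y ∈ V × U ⊥ V)
proposition6p16 D continuous x y x-max y-max =
  mk⇔ (#⇒HausdorffSeparated D continuous x-max y-max) (HausdorffSeparated⇒# D)
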